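{- Let $n$ be a positive integer and $k\ge2$ a divisor of $n$. Then the deterministic query complexity of $\textsc{1-vs- }k\textsc{ -Cycle}$ on $n$ vertices satisfies $D(\textsc{1-vs- }k\textsc{ -Cycle})\ge\frac{n^2}{128k^2}$.
   Context: Graphs on $n$ vertices are encoded by adjacency matrix bits, i.e. as strings in $\{0,1\}^N$, $N=\binom n2$, one bit per vertex pair. $\textsc{1-vs- }k\textsc{ -Cycle}:\Delta\to\{0,1\}$ is the partial Boolean function whose domain $\Delta$ consists of all $n$-vertex graphs that are a single cycle of length $n$ (value $1$) or a disjoint union of $k$ cycles each of length $n/k$ (value $0$). For a partial $g:\Delta\to\{0,1\}$, $D(g)$ is the minimum, over all total $f:\{0,1\}^N\to\{0,1\}$ agreeing with $g$ on $\Delta$, of the minimum depth of a deterministic decision tree (querying input bits) computing $f$.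
   Formalization: The formal theorem adds the assumption n ≥ 3k, so that cycles of length n/k exist; for n/k = 1 or 2 there are no 0-instances, the function is constant with D = 0, and the stated bound fails (e.g. n = 4, k = 2). -}

module Defs where

open import Data.Nat using (ℕ; zero; suc; _≟_)
open import Data.Fin using (Fin; toℕ; _<_)
open import Data.Fin.Properties using (<-cmp)
open import Data.Bool using (Bool; true; false; if_then_else_)
open import Data.Product using (Σ; Σ-syntax; _×_; _,_)
open import Data.Sum using (_⊎_)
open import Relation.Binary.PropositionalEquality using (_≡_)
open import Relation.Binary.Definitions using (tri<; tri≈; tri>)
open import Relation.Nullary.Decidable using (⌊_⌋)
open import Function.Bundles using (_⤖_; Bijection; _⇔_)

Pair : ℕ → Set
Pair n = Σ[ i ∈ Fin n ] Σ[ j ∈ Fin n ] (i < j)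

Input : ℕ → Set
Input n = Pair n → Bool

adj : ∀ {n} → Input n → Fin n → Fin n → Bool
adj x i j with <-cmp i j
... | tri< i<j _ _ = x (i , j , i<j)
... | tri≈ _ _ _   = false
... | tri> _ _ j<i = x (j , i , j<i)

data DTree (I : Set) : Set where
  leaf : Bool → DTree I
  node : I → DTree I → DTree I → DTree I   -- query i; left if bit 0, right if bit 1

eval : ∀ {I} → DTree I → (I → Bool) → Bool
eval (leaf b) x = b
eval (node i t₀ t₁) x = if x i then eval t₁ x else eval t₀ x

depth : ∀ {I} → DTree I → ℕ
depth (leaf _) = 0
depth (node _ t₀ t₁) = suc (Data.Nat._⊔_ (depth t₀) (depth t₁))
  where import Data.Nat

-- successor modulo m on ℕ (for t < m)
nextMod : ℕ → ℕ → ℕ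
nextMod m t = if ⌊ suc t ≟ m ⌋ then 0 else suc t

Consec : (m : ℕ) → Fin m → Fin m → Set
Consec m t s = (toℕ s ≡ nextMod m (toℕ t)) ⊎ (toℕ t ≡ nextMod m (toℕ s))

-- The graph encoded by x is a disjoint union of k cycles each of length m,
-- covering all n vertices: there is a bijection σ : Fin k × Fin m → Fin n
-- (cycle index, position on cycle) such that σ(a,t) and σ(b,s) are adjacent
-- exactly when a = b and t, s are consecutive modulo m.
-- (For m ≥ 3 this is exactly "k vertex-disjoint m-cycles spanning the graph".)
IsCycleUnion : (n k m : ℕ) → Input n → Set
IsCycleUnion n k m x =
  Σ[ σ ∈ (Fin k × Fin m) ⤖ Fin n ]
    (∀ a t b s →
      let f = Bijection.to σ in
      (adj x (f (a , t)) (f (b , s)) ≡ true) ⇔ ((a ≡ b) × Consec m t s))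

{-# OPTIONS --safe #-}

-- An adversary maintains k disjoint m-cycles avoiding the set F of pairs answered 0,
-- and calls a vertex heavy once it lies in at least m/4 pairs of F.  A queried edge
-- uv of the current graph with a heavy end is answered 1.  If both ends are light,
-- uv is exchanged for other edges: remove uv and another light edge ab of the same
-- cycle, add ua and vb (a 2-opt move), and answer 0.  While fewer than m²/128 pairs
-- are in F there are fewer than m/16 heavy vertices, so an admissible ab exists.
-- Edges with a heavy end are never removed, hence the final graph is consistent with
-- all answers.  By the same counting its cycles can be joined one after another
-- through light edges without using F, so a Hamiltonian cycle is consistent as well.

module Submission where

open import Defs
open import Data.Nat using (ℕ; zero; suc; _+_; _*_; _∸_; _≤_; _<_; _/_; NonZero; z≤n; s≤s; _≤?_; _≟_)
open import Data.Nat.Divisibility using (_∣_)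
open import Data.Nat.DivMod using (m/n*n≡m)
open import Data.Nat.ListAction using (sum)
open import Data.Nat.Properties
open import Data.Nat.Tactic.RingSolver using (solve-∀)
open import Data.Bool using (Bool; true; false; if_then_else_)
open import Data.Fin as Fin using (Fin; zero; suc; toℕ)
import Data.Fin.Properties as Fin
open import Data.List using (List; []; _∷_; _++_; [_]; length; map; concat; filter; reverse; allFin; tabulate; lookup; take; drop)
open import Data.List.Properties using (++-assoc; ++-identityʳ; filter-all; length-++; length-drop; length-map; length-tabulate; length-take; reverse-involutive; tabulate-lookup; take++drop≡id; unfold-reverse)
import Data.List.Membership.DecPropositional as DecMembership
open import Data.List.Membership.Propositional using (_∈_; _∉_; find; lose)
open import Data.List.Membership.Propositional.Properties using (∈-++⁺ˡ; ∈-++⁺ʳ; ∈-++⁻; ∈-∃++; ∈-allFin; ∈-filter⁺; ∈-filter⁻; ∈-tabulate⁻)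
open import Data.List.Relation.Binary.Permutation.Propositional using (_↭_; ↭-refl; ↭-reflexive; ↭-sym; ↭-trans; ↭⇒↭ₛ; prep; swap)
import Data.List.Relation.Binary.Permutation.Propositional as Perm
open import Data.List.Relation.Binary.Permutation.Propositional.Properties using (All-resp-↭; Any-resp-↭; ∈-resp-↭; ↭-length; ↭-reverse; ∷↭∷ʳ; ++⁺; ++⁺ˡ; ++⁺ʳ; shift; shifts)
import Data.List.Relation.Binary.Permutation.Propositional.Properties as Perm
import Data.List.Relation.Binary.Permutation.Setoid.Properties as Setoid↭
open import Data.List.Relation.Unary.All as All using (All; []; _∷_)
import Data.List.Relation.Unary.All.Properties as All
open import Data.List.Relation.Unary.AllPairs as AllPairs using (AllPairs; []; _∷_)
import Data.List.Relation.Unary.AllPairs.Properties as AllPairs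
open import Data.List.Relation.Unary.Any as Any using (Any; here; there)
import Data.List.Relation.Unary.Any.Properties as Any
open import Data.List.Relation.Unary.Unique.Propositional using (Unique)
import Data.List.Relation.Unary.Unique.Propositional.Properties as Unique
open import Data.Product using (Σ-syntax; ∃-syntax; ∃₂; _×_; _,_; proj₁; proj₂)
open import Data.Product.Properties using (≡-dec)
open import Data.Sum as Sum using (_⊎_; inj₁; inj₂; [_,_]′)
open import Function using (_∘_; id; case_of_)
open import Function.Bundles using (mk⇔; mk⤖)
open import Function.Consequences.Propositional using (strictlySurjective⇒surjective)
open import Relation.Binary using (Decidable; tri<; tri≈; tri>)
open import Relation.Binary.PropositionalEquality as ≡ using (_≡_; _≢_; refl; sym; cong; cong₂; subst; subst₂)
open import Relation.Nullary using (¬_; Dec; yes; no; ¬?; contradiction)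
open import Relation.Nullary.Decidable using (⌊_⌋; _⊎-dec_)

-- Lists and paths

private variable
  A B C : Set

Unique-resp-↭ : ∀ {xs ys : List A} → xs ↭ ys → Unique xs → Unique ys
Unique-resp-↭ p = Setoid↭.Unique-resp-↭ (≡.setoid _) (↭⇒↭ₛ p)

Unique-++⁻ : ∀ (xs : List A) {ys} → Unique (xs ++ ys) →
             Unique xs × Unique ys × (∀ {z} → z ∈ xs → z ∉ ys)
Unique-++⁻ []       u        = [] , u , λ ()
Unique-++⁻ (x ∷ xs) (x∉ ∷ u) with Unique-++⁻ xs u
... | uxs , uys , disj =
  All.++⁻ˡ xs x∉ ∷ uxs , uys ,
  λ { (here refl) z∈ys → All.lookup (All.++⁻ʳ xs x∉) z∈ys refl
    ; (there z∈xs)  z∈ys → disj z∈xs z∈ys }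

concat-↭ : {xss yss : List (List A)} → xss ↭ yss → concat xss ↭ concat yss
concat-↭ Perm.refl        = ↭-refl
concat-↭ (prep xs p)      = ++⁺ˡ xs (concat-↭ p)
concat-↭ (swap xs ys p)   = ↭-trans (shifts xs ys) (++⁺ˡ ys (++⁺ˡ xs (concat-↭ p)))
concat-↭ (Perm.trans p q) = ↭-trans (concat-↭ p) (concat-↭ q)

-- Pigeonhole for candidates of which no blocker hits two

module _ {R : B → C → Set} (R? : Decidable R) where

  private
    Exclusive : List B → Set
    Exclusive = AllPairs (λ e e′ → ∀ c → R e c → ¬ R e′ c)

  length-filter-exclusive : ∀ c es → Exclusive es →
    length es ≤ suc (length (filter (λ e → ¬? (R? e c)) es))
  length-filter-exclusive c []       _        = z≤n
  length-filter-exclusive c (e ∷ es) (x ∷ xs) with R? e c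
  ... | yes r = s≤s (≤-reflexive (sym (cong length
                  (filter-all (λ e → ¬? (R? e c)) (All.map (λ f → f c r) x)))))
  ... | no _  = s≤s (length-filter-exclusive c es xs)

  -- By exclusivity each `c` rules out at most one candidate, so filtering by one blocker costs at
  -- most one element and the strict inequality survives the induction.
  unblocked : ∀ cs es → Exclusive es → length cs < length es →
    ∃[ e ] e ∈ es × All (λ c → ¬ R e c) cs
  unblocked []       (e ∷ es) _ _  = e , here refl , []
  unblocked (c ∷ cs) es       x lt
    with unblocked cs (filter (λ e → ¬? (R? e c)) es)
           (AllPairs.filter⁺ (λ e → ¬? (R? e c)) x)
           (≤-pred (≤-trans lt (length-filter-exclusive c es x)))
  ... | e , e∈ , free with ∈-filter⁻ (λ e → ¬? (R? e c)) {xs = es} e∈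
  ...   | e∈es , ¬r = e , e∈es , ¬r ∷ free

-- Paths and cycles as lists of directed edges

path : A → List A → A → List (A × A)
path x []       z = [ x , z ]
path x (y ∷ ys) z = (x , y) ∷ path y ys z

cyc : List A → List (A × A)
cyc []       = []
cyc (x ∷ xs) = path x xs x

-- `cyc` lists the edges in the direction of traversal. `Link` forgets the direction, because a
-- 2-opt move reverses part of the cycle.
Link : List A → A → A → Set
Link c p q = (p , q) ∈ cyc c ⊎ (q , p) ∈ cyc c

Adj : List (List A) → A → A → Set
Adj cs p q = Any (λ c → Link c p q) cs

path-++ : ∀ (x : A) ys {y zs z} → path x (ys ++ y ∷ zs) z ≡ path x ys y ++ path y zs z
path-++ x []       = refl
path-++ x (w ∷ ys) = cong ((x , w) ∷_) (path-++ w ys)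

map-proj₁-path : ∀ (x : A) ys z → map proj₁ (path x ys z) ≡ x ∷ ys
map-proj₁-path x []       z = refl
map-proj₁-path x (y ∷ ys) z = cong (x ∷_) (map-proj₁-path y ys z)

map-proj₂-path : ∀ (x : A) ys z → map proj₂ (path x ys z) ≡ ys ++ [ z ]
map-proj₂-path x []       z = refl
map-proj₂-path x (y ∷ ys) z = cong (y ∷_) (map-proj₂-path y ys z)

length-path : ∀ (x : A) ys z → length (path x ys z) ≡ suc (length ys)
length-path x []       z = refl
length-path x (y ∷ ys) z = cong suc (length-path y ys z)

∈-path-ends : ∀ {x : A} {ys z p q} → (p , q) ∈ path x ys z → p ∈ x ∷ ys × q ∈ ys ++ [ z ]
∈-path-ends {ys = []}     (here refl) = here refl , here refl
∈-path-ends {ys = y ∷ ys} (here refl) = here refl , here refl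
∈-path-ends {ys = y ∷ ys} (there e)     with ∈-path-ends {ys = ys} e
... | p∈ , q∈ = there p∈ , there q∈

path-reverse : ∀ {x : A} ys {z p q} → (p , q) ∈ path x ys z → (q , p) ∈ path z (reverse ys) x
path-reverse []       (here refl) = here refl
path-reverse {x = x} (y ∷ ys) {z} e
  rewrite unfold-reverse y ys | path-++ z (reverse ys) {y} {[]} {x} with e
... | here refl = ∈-++⁺ʳ (path z (reverse ys) y) (here refl)
... | there e′    = ∈-++⁺ˡ (path-reverse ys e′)

path-reverse⁻ : ∀ {x : A} ys {z p q} → (p , q) ∈ path z (reverse ys) x → (q , p) ∈ path x ys z
path-reverse⁻ {x = x} ys {z} {p} {q} e =
  subst (λ l → (q , p) ∈ path x l z) (reverse-involutive ys) (path-reverse (reverse ys) e)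

cyc-rotate : ∀ (xs ys : List A) → cyc (xs ++ ys) ↭ cyc (ys ++ xs)
cyc-rotate []       ys = ↭-reflexive (cong cyc (sym (++-identityʳ ys)))
cyc-rotate (x ∷ xs) [] = ↭-reflexive (cong cyc (++-identityʳ (x ∷ xs)))
cyc-rotate (x ∷ xs) (y ∷ ys)
  rewrite path-++ x xs {y} {ys} {x} | path-++ y ys {x} {xs} {y} =
  Perm.++-comm (path x xs y) (path y ys x)

∈-path-split : ∀ {x : A} ys {z p q} → (p , q) ∈ path x ys z →
  (∃[ ps ] x ∷ ys ≡ ps ++ [ p ] × q ≡ z) ⊎ (∃₂ λ ps qs → x ∷ ys ≡ ps ++ p ∷ q ∷ qs)
∈-path-split []       (here refl) = inj₁ ([] , refl , refl)
∈-path-split (y ∷ ys) (here refl) = inj₂ ([] , ys , refl)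
∈-path-split {x = x} (y ∷ ys) (there e) with ∈-path-split ys e
... | inj₁ (ps , eq , q≡z) = inj₁ (x ∷ ps , cong (x ∷_) eq , q≡z)
... | inj₂ (ps , qs , eq)  = inj₂ (x ∷ ps , qs , cong (x ∷_) eq)

-- A rotation permutes the edge list, so any chosen edge may be assumed to come first; all surgery
-- on cycles is done in this normal form. The length bound excludes the one-vertex cycle, whose only
-- edge is a loop.
∈-cyc-rotate : ∀ (c : List A) {u v} → 2 ≤ length c → (u , v) ∈ cyc c →
  ∃[ xs ] c ↭ u ∷ v ∷ xs × cyc c ↭ cyc (u ∷ v ∷ xs)
∈-cyc-rotate (x ∷ ys) {u} {v} 2≤ e with ∈-path-split ys e
... | inj₂ (ps , qs , eq) =
  qs ++ ps ,
  ↭-trans (↭-reflexive eq) (Perm.++-comm ps (u ∷ v ∷ qs)) ,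
  ↭-trans (↭-reflexive (cong cyc eq)) (cyc-rotate ps (u ∷ v ∷ qs))
... | inj₁ ([] , refl , _) = contradiction 2≤ λ { (s≤s ()) }
... | inj₁ (p ∷ ps , refl , refl) =
  ps , Perm.++-comm (v ∷ ps) [ u ] , cyc-rotate (v ∷ ps) [ u ]

∈-path-inner : ∀ {x : A} ys {z p q} → (p , q) ∈ path x ys z → p ≢ x → q ≢ z →
  ∃₂ λ ps qs → ys ≡ ps ++ p ∷ q ∷ qs
∈-path-inner ys e p≢x q≢z with ∈-path-split ys e
... | inj₁ (_ , _ , q≡z)           = contradiction q≡z q≢z
... | inj₂ ([] , qs , refl)      = contradiction refl p≢x
... | inj₂ (_ ∷ ps , qs , refl) = ps , qs , refl

-- Local surgery: switching within a cycle and merging two cycles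

Same : A → A → A → A → Set
Same p q u v = (p ≡ u × q ≡ v) ⊎ (p ≡ v × q ≡ u)

Same-sym : ∀ {p q u v : A} → Same q p u v → Same p q u v
Same-sym (inj₁ (a , b)) = inj₂ (b , a)
Same-sym (inj₂ (a , b)) = inj₁ (b , a)

module _ {u v a b : A} (ys zs : List A) where

  -- The 2-opt move on u v ys a b zs: uv and ab are replaced by ua and vb.
  switch : List A
  switch = u ∷ a ∷ reverse ys ++ v ∷ b ∷ zs

  private
    c : List A
    c = u ∷ v ∷ ys ++ a ∷ b ∷ zs

    cyc-c : cyc c ≡ (u , v) ∷ path v ys a ++ (a , b) ∷ path b zs u
    cyc-c = cong ((u , v) ∷_) (path-++ v ys)

    cyc-switch : cyc switch ≡ (u , a) ∷ path a (reverse ys) v ++ (v , b) ∷ path b zs u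
    cyc-switch = cong ((u , a) ∷_) (path-++ a (reverse ys))

  switch-↭ : switch ↭ c
  switch-↭ = prep u (↭-trans (prep a (↭-trans (shift v (reverse ys) (b ∷ zs))
      (prep v (++⁺ʳ (b ∷ zs) (↭-reverse ys)))))
    (↭-trans (swap a v ↭-refl) (prep v (↭-sym (shift a ys (b ∷ zs))))))

  private
    -- The stretch from `v` to `a` is traversed backwards after the move, so its edges reappear with
    -- their ends exchanged; the stretch from `b` back to `u` is untouched.
    keep : ∀ {p q} → (p , q) ∈ cyc c → Link switch p q ⊎ Same p q u v ⊎ Same p q a b
    keep {p} {q} e rewrite cyc-switch with subst ((p , q) ∈_) cyc-c e
    ... | here refl = inj₂ (inj₁ (inj₁ (refl , refl)))
    ... | there e′ with ∈-++⁻ (path v ys a) e′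
    ...   | inj₁ e″            = inj₁ (inj₂ (there (∈-++⁺ˡ (path-reverse ys e″))))
    ...   | inj₂ (here refl) = inj₂ (inj₂ (inj₁ (refl , refl)))
    ...   | inj₂ (there e″)    = inj₁ (inj₁ (there (∈-++⁺ʳ (path a (reverse ys) v) (there e″))))

    -- Uniqueness separates the surviving edges from uv: the reversed stretch between `v` and `a`
    -- does not meet `u`, and the stretch from `b` to `u` does not meet `v`.
    new : Unique c → ∀ {p q} → (p , q) ∈ cyc switch →
          (Link c p q × ¬ Same p q u v) ⊎ Same p q u a ⊎ Same p q v b
    new uniq {p} {q} e rewrite cyc-c with subst ((p , q) ∈_) cyc-switch e
    ... | here refl = inj₂ (inj₁ (inj₁ (refl , refl)))
    ... | there e′ with ∈-++⁻ (path a (reverse ys) v) e′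
    ...   | inj₂ (here refl) = inj₂ (inj₂ (inj₁ (refl , refl)))
    ...   | inj₁ e″ = inj₁ (inj₂ (there (∈-++⁺ˡ r)) ,
              λ { (inj₁ (refl , _)) → u∉ (proj₂ (∈-path-ends r))
                ; (inj₂ (_ , refl)) → u∉′ (proj₁ (∈-path-ends r)) })
      where
      r : (q , p) ∈ path v ys a
      r = path-reverse⁻ ys e″
      left : ∀ {w} → w ∈ ys ++ [ a ] → w ∈ ys ++ a ∷ b ∷ zs
      left w∈ with ∈-++⁻ ys w∈
      ... | inj₁ w∈ys         = ∈-++⁺ˡ w∈ys
      ... | inj₂ (here refl) = ∈-++⁺ʳ ys (here refl)
      u∉ : u ∉ ys ++ [ a ]
      u∉ w∈ = All.lookup (AllPairs.head uniq) (there (left w∈)) refl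
      u∉′ : u ∉ v ∷ ys
      u∉′ (here refl) = All.lookup (AllPairs.head uniq) (here refl) refl
      u∉′ (there w∈)    = All.lookup (AllPairs.head uniq) (there (∈-++⁺ˡ w∈)) refl
    ...   | inj₂ (there e″) = inj₁ (inj₁ (there (∈-++⁺ʳ (path v ys a) (there e″))) ,
              λ { (inj₁ (_ , refl)) → v∉′ (proj₂ (∈-path-ends e″))
                ; (inj₂ (refl , _)) → v∉ (proj₁ (∈-path-ends e″)) })
      where
      v∉ : v ∉ b ∷ zs
      v∉ w∈ = All.lookup (AllPairs.head (AllPairs.tail uniq)) (∈-++⁺ʳ ys (there w∈)) refl
      v∉′ : v ∉ zs ++ [ u ]
      v∉′ w∈ with ∈-++⁻ zs w∈
      ... | inj₁ w∈zs          = v∉ (there w∈zs)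
      ... | inj₂ (here refl) = All.lookup (AllPairs.head uniq) (here refl) refl

  switch-keeps : ∀ {p q} → Link c p q → Link switch p q ⊎ Same p q u v ⊎ Same p q a b
  switch-keeps (inj₁ e) = keep e
  switch-keeps (inj₂ e) = Sum.map Sum.swap (Sum.map Same-sym Same-sym) (keep e)

  switch-new : Unique c → ∀ {p q} → Link switch p q →
    (Link c p q × ¬ Same p q u v) ⊎ Same p q u a ⊎ Same p q v b
  switch-new uniq (inj₁ e) = new uniq e
  switch-new uniq (inj₂ e) = Sum.map (λ (l , ¬s) → Sum.swap l , ¬s ∘ Same-sym)
                                     (Sum.map Same-sym Same-sym) (new uniq e)

module _ {u v a b : A} (xs ys : List A) where

  -- Joins the cycles u v xs and a b ys: uv and ab are replaced by ub and av.
  merge : List A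
  merge = v ∷ xs ++ u ∷ b ∷ ys ++ [ a ]

  private
    cyc-merge : cyc merge ≡ path v xs u ++ (u , b) ∷ path b ys a ++ [ a , v ]
    cyc-merge = ≡.trans (path-++ v xs)
      (cong (λ l → path v xs u ++ (u , b) ∷ l) (path-++ b ys))

  merge-↭ : merge ↭ (u ∷ v ∷ xs) ++ (a ∷ b ∷ ys)
  merge-↭ = ↭-trans (shift u (v ∷ xs) (b ∷ ys ++ [ a ]))
    (++⁺ˡ (u ∷ v ∷ xs) (↭-sym (∷↭∷ʳ a (b ∷ ys))))

  private
    keep₁ : ∀ {p q} → (p , q) ∈ cyc (u ∷ v ∷ xs) → (p , q) ∈ cyc merge ⊎ Same p q u v
    keep₁ (here refl) = inj₂ (inj₁ (refl , refl))
    keep₁ (there e)     = inj₁ (subst (_ ∈_) (sym cyc-merge) (∈-++⁺ˡ e))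

    keep₂ : ∀ {p q} → (p , q) ∈ cyc (a ∷ b ∷ ys) → (p , q) ∈ cyc merge ⊎ Same p q a b
    keep₂ (here refl) = inj₂ (inj₁ (refl , refl))
    keep₂ (there e)     = inj₁ (subst (_ ∈_) (sym cyc-merge)
      (∈-++⁺ʳ (path v xs u) (there (∈-++⁺ˡ e))))

    new : ∀ {p q} → (p , q) ∈ cyc merge →
      (p , q) ∈ cyc (u ∷ v ∷ xs) ⊎ (p , q) ∈ cyc (a ∷ b ∷ ys) ⊎ Same p q u b ⊎ Same p q v a
    new {p} {q} e with ∈-++⁻ (path v xs u) (subst ((p , q) ∈_) cyc-merge e)
    ... | inj₁ e′            = inj₁ (there e′)
    ... | inj₂ (here refl) = inj₂ (inj₂ (inj₁ (inj₁ (refl , refl))))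
    ... | inj₂ (there e′) with ∈-++⁻ (path b ys a) e′
    ...   | inj₁ e″            = inj₂ (inj₁ (there e″))
    ...   | inj₂ (here refl) = inj₂ (inj₂ (inj₂ (inj₂ (refl , refl))))

  merge-keeps₁ : ∀ {p q} → Link (u ∷ v ∷ xs) p q → Link merge p q ⊎ Same p q u v
  merge-keeps₁ (inj₁ e) = Sum.map inj₁ id (keep₁ e)
  merge-keeps₁ (inj₂ e) = Sum.map inj₂ Same-sym (keep₁ e)

  merge-keeps₂ : ∀ {p q} → Link (a ∷ b ∷ ys) p q → Link merge p q ⊎ Same p q a b
  merge-keeps₂ (inj₁ e) = Sum.map inj₁ id (keep₂ e)
  merge-keeps₂ (inj₂ e) = Sum.map inj₂ Same-sym (keep₂ e)

  merge-new : ∀ {p q} → Link merge p q →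
    Link (u ∷ v ∷ xs) p q ⊎ Link (a ∷ b ∷ ys) p q ⊎ Same p q u b ⊎ Same p q v a
  merge-new (inj₁ e) = Sum.map inj₁ (Sum.map inj₁ id) (new e)
  merge-new (inj₂ e) = Sum.map inj₂ (Sum.map inj₂ (Sum.map Same-sym Same-sym)) (new e)

-- Uniqueness of the concatenation expresses at once that each cycle is simple and that the cycles
-- are disjoint. On `Fin n` with `k * m ≡ n`, that the cycles span all vertices follows by counting.
record CycleSystem {A : Set} (k m : ℕ) (cs : List (List A)) : Set where
  constructor system
  field
    count  : length cs ≡ k
    sizes  : All (λ c → length c ≡ m) cs
    unique : Unique (concat cs)

open CycleSystem public

module _ {A : Set} where

  Link-ends : ∀ (c : List A) {p q} → Link c p q → p ∈ c × q ∈ c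
  Link-ends c (inj₁ e) = ends c e
    where
    ends : ∀ c {p q} → (p , q) ∈ cyc c → p ∈ c × q ∈ c
    ends (x ∷ xs) e with ∈-path-ends {ys = xs} e
    ... | p∈ , q∈ = p∈ , ∈-resp-↭ (↭-sym (∷↭∷ʳ x xs)) q∈
  Link-ends c (inj₂ e) with Link-ends c (inj₁ e)
  ... | q∈ , p∈ = p∈ , q∈

  Link-resp-↭ : ∀ (c d : List A) {p q} → cyc c ↭ cyc d → Link c p q → Link d p q
  Link-resp-↭ _ _ σ = Sum.map (∈-resp-↭ σ) (∈-resp-↭ σ)

  Adj-ends : ∀ {cs : List (List A)} {p q} → Adj cs p q → p ∈ concat cs × q ∈ concat cs
  Adj-ends {c ∷ cs} (here l) with Link-ends c l
  ... | p∈ , q∈ = ∈-++⁺ˡ p∈ , ∈-++⁺ˡ q∈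
  Adj-ends {c ∷ cs} (there l) with Adj-ends l
  ... | p∈ , q∈ = ∈-++⁺ʳ c p∈ , ∈-++⁺ʳ c q∈

  Adj-sym : ∀ {cs : List (List A)} {p q} → Adj cs p q → Adj cs q p
  Adj-sym = Any.map Sum.swap

-- Graphs of cycle systems

Unique-tabulate⁻ : ∀ {A : Set} {r} (f : Fin r → A) → Unique (tabulate f) → ∀ {i j} → f i ≡ f j → i ≡ j
Unique-tabulate⁻ f _        {zero}  {zero}  _  = refl
Unique-tabulate⁻ f (x∉ ∷ _) {zero}  {suc j} eq = contradiction eq (All.tabulate⁻ x∉ j)
Unique-tabulate⁻ f (x∉ ∷ _) {suc i} {zero}  eq = contradiction (sym eq) (All.tabulate⁻ x∉ i)
Unique-tabulate⁻ f (_ ∷ u)  {suc i} {suc j} eq = cong suc (Unique-tabulate⁻ (f ∘ suc) u eq)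

Unique-length≤ : ∀ {n} (xs : List (Fin n)) → Unique xs → length xs ≤ n
Unique-length≤ xs u = Fin.injective⇒≤
  (Unique-tabulate⁻ (lookup xs) (subst Unique (sym (tabulate-lookup xs)) u))

-- A missing `y` could be put in front of `xs`, giving a duplicate-free list of more than `n`
-- elements of `Fin n`.
Unique-covers : ∀ {n} (xs : List (Fin n)) → Unique xs → length xs ≡ n → ∀ y → y ∈ xs
Unique-covers xs u eq y with DecMembership._∈?_ Fin._≟_ y xs
... | yes y∈ = y∈
... | no y∉  = contradiction (≤-reflexive (sym eq)) (<⇒≱
  (Unique-length≤ (y ∷ xs) (All.tabulate (λ z∈ y≡z → y∉ (subst (_∈ xs) (sym y≡z) z∈)) ∷ u)))

length-concat : ∀ {A : Set} {m} (xss : List (List A)) → All (λ xs → length xs ≡ m) xss →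
  length (concat xss) ≡ length xss * m
length-concat []         []         = refl
length-concat (xs ∷ xss) (eq ∷ eqs) = ≡.trans (length-++ xs) (cong₂ _+_ eq (length-concat xss eqs))

-- Passes from lists to a map on cycle indices and positions, the shape of the bijection demanded by
-- `IsCycleUnion`.
tabulation : ∀ {A : Set} {k m} (xss : List (List A)) → length xss ≡ k → All (λ xs → length xs ≡ m) xss →
  Σ[ g ∈ (Fin k → Fin m → A) ] xss ≡ tabulate (λ a → tabulate (g a))
tabulation []         refl []           = (λ ()) , refl
tabulation (xs ∷ xss) refl (refl ∷ eqs) with tabulation xss refl eqs
... | g , eq = (λ { zero → lookup xs ; (suc a) → g a }) , cong₂ _∷_ (sym (tabulate-lookup xs)) eq

tabulation-injective : ∀ {A : Set} {k m} (g : Fin k → Fin m → A) →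
  Unique (concat (tabulate (λ a → tabulate (g a)))) →
  ∀ {a t b s} → g a t ≡ g b s → a ≡ b × t ≡ s
tabulation-injective {k = suc k} g u {a} {t} {b} {s} eq with Unique-++⁻ (tabulate (g zero)) u
... | u₀ , u₁ , disj = by a b eq
  where
  ∈-row : ∀ {k m} (g : Fin k → Fin m → _) a t → g a t ∈ concat (tabulate (λ a → tabulate (g a)))
  ∈-row g a t = Any.concat⁺ (Any.tabulate⁺ a (Any.tabulate⁺ t refl))
  by : ∀ a b → g a t ≡ g b s → a ≡ b × t ≡ s
  by zero    zero    eq = refl , Unique-tabulate⁻ (g zero) u₀ eq
  by zero    (suc b) eq = contradiction (∈-row (g ∘ suc) b s)
    (disj (subst (_∈ tabulate (g zero)) eq (Any.tabulate⁺ t refl)))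
  by (suc a) zero    eq = contradiction (∈-row (g ∘ suc) a t)
    (disj (subst (_∈ tabulate (g zero)) (sym eq) (Any.tabulate⁺ s refl)))
  by (suc a) (suc b) eq with tabulation-injective (g ∘ suc) u₁ eq
  ... | a≡b , t≡s = cong suc a≡b , t≡s

nextMod-last : ∀ {m t} → suc t ≡ m → nextMod m t ≡ 0
nextMod-last {m} {t} eq with suc t ≟ m
... | yes _ = refl
... | no ≢  = contradiction eq ≢

nextMod-inner : ∀ {m t} → suc t ≢ m → nextMod m t ≡ suc t
nextMod-inner {m} {t} ≢m with suc t ≟ m
... | yes eq = contradiction eq ≢m
... | no _   = refl

nextMod-≢ : ∀ {m t} → 2 ≤ m → t ≢ nextMod m t
nextMod-≢ {m} {t} 2≤m eq with suc t ≟ m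
nextMod-≢ (s≤s ()) refl | yes refl
... | no _ = contradiction (sym eq) 1+n≢n

module _ {A : Set} where

  ∈-path-tabulate⁻ : ∀ {r} (f : Fin (suc r) → A) {z p q} →
    (p , q) ∈ path (f zero) (tabulate (f ∘ suc)) z →
    ∃[ t ] p ≡ f t × ((∃[ s ] q ≡ f s × toℕ s ≡ suc (toℕ t)) ⊎ (q ≡ z × toℕ t ≡ r))
  ∈-path-tabulate⁻ {zero}  f (here refl) = zero , refl , inj₂ (refl , refl)
  ∈-path-tabulate⁻ {suc r} f (here refl) = zero , refl , inj₁ (suc zero , refl , refl)
  ∈-path-tabulate⁻ {suc r} f (there e) with ∈-path-tabulate⁻ (f ∘ suc) e
  ... | t , p≡ , inj₁ (s , q≡ , s≡) = suc t , p≡ , inj₁ (suc s , q≡ , cong suc s≡)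
  ... | t , p≡ , inj₂ (q≡ , t≡)     = suc t , p≡ , inj₂ (q≡ , cong suc t≡)

  ∈-path-tabulate⁺ : ∀ {r} (f : Fin (suc r) → A) {z} t s → toℕ s ≡ suc (toℕ t) →
    (f t , f s) ∈ path (f zero) (tabulate (f ∘ suc)) z
  ∈-path-tabulate⁺ {suc r} f zero    (suc zero) _  = here refl
  ∈-path-tabulate⁺ {suc r} f (suc t) (suc s)    eq = there (∈-path-tabulate⁺ (f ∘ suc) t s (suc-injective eq))

  ∈-path-tabulate-last : ∀ {r} (f : Fin (suc r) → A) {z} t → toℕ t ≡ r →
    (f t , z) ∈ path (f zero) (tabulate (f ∘ suc)) z
  ∈-path-tabulate-last {zero}  f zero    _  = here refl
  ∈-path-tabulate-last {suc r} f (suc t) eq = there (∈-path-tabulate-last (f ∘ suc) t (suc-injective eq))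

  ∈-cyc-tabulate⁻ : ∀ {m} (f : Fin m → A) {p q} → (p , q) ∈ cyc (tabulate f) →
    ∃₂ λ t s → p ≡ f t × q ≡ f s × toℕ s ≡ nextMod m (toℕ t)
  ∈-cyc-tabulate⁻ {suc r} f e with ∈-path-tabulate⁻ f e
  ... | t , p≡ , inj₁ (s , q≡ , s≡) = t , s , p≡ , q≡ ,
        ≡.trans s≡ (sym (nextMod-inner (λ eq → <-irrefl (≡.trans s≡ eq) (Fin.toℕ<n s))))
  ... | t , p≡ , inj₂ (q≡ , t≡)     = t , zero , p≡ , q≡ , sym (nextMod-last (cong suc t≡))

  ∈-cyc-tabulate⁺ : ∀ {m} (f : Fin m → A) t s → toℕ s ≡ nextMod m (toℕ t) → (f t , f s) ∈ cyc (tabulate f)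
  ∈-cyc-tabulate⁺ {suc r} f t s eq with toℕ t ≟ r
  ... | no t≢  = ∈-path-tabulate⁺ f t s (≡.trans eq (nextMod-inner (t≢ ∘ suc-injective)))
  ... | yes t≡ = subst (λ s → (f t , f s) ∈ cyc (tabulate f))
        (sym (Fin.toℕ-injective {j = zero} (≡.trans eq (nextMod-last (cong suc t≡)))))
        (∈-path-tabulate-last f t t≡)

  Link-tabulate : ∀ {m} (f : Fin m → A) {p q} → Link (tabulate f) p q →
    ∃₂ λ t s → p ≡ f t × q ≡ f s × Consec m t s
  Link-tabulate f (inj₁ e) with ∈-cyc-tabulate⁻ f e
  ... | t , s , p≡ , q≡ , eq = t , s , p≡ , q≡ , inj₁ eq
  Link-tabulate f (inj₂ e) with ∈-cyc-tabulate⁻ f e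
  ... | t , s , q≡ , p≡ , eq = s , t , p≡ , q≡ , inj₂ eq

module _ {n : ℕ} where

  adj? : ∀ (cs : List (List (Fin n))) p q → Dec (Adj cs p q)
  adj? cs p q = Any.any? (λ c → ((p , q) ∈? cyc c) ⊎-dec ((q , p) ∈? cyc c)) cs
    where open DecMembership (≡-dec Fin._≟_ Fin._≟_) using (_∈?_)

  graph : List (List (Fin n)) → Input n
  graph cs (i , j , _) = ⌊ adj? cs i j ⌋

  adj-query : ∀ (x : Input n) {i j} (i<j : i Fin.< j) → adj x i j ≡ x (i , j , i<j)
  adj-query x {i} {j} i<j with Fin.<-cmp i j
  ... | tri< lt _ _ = cong (λ l → x (i , j , l)) (Fin.<-irrelevant lt i<j)
  ... | tri≈ ≮ _ _  = contradiction i<j ≮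
  ... | tri> ≮ _ _  = contradiction i<j ≮

  adj-sym : ∀ (x : Input n) i j → adj x i j ≡ adj x j i
  adj-sym x i j with Fin.<-cmp i j
  ... | tri< lt _ _   = sym (adj-irr lt)
    where
    adj-irr : (lt : i Fin.< j) → adj x j i ≡ x (i , j , lt)
    adj-irr lt with Fin.<-cmp j i
    ... | tri< _ _ ≯   = contradiction lt ≯
    ... | tri≈ _ _ ≯   = contradiction lt ≯
    ... | tri> _ _ lt′ = cong (λ l → x (i , j , l)) (Fin.<-irrelevant lt′ lt)
  ... | tri≈ _ refl _ with Fin.<-cmp i i
  ...   | tri< lt _ _ = contradiction lt (<-irrefl refl)
  ...   | tri≈ _ _ _  = refl
  ...   | tri> _ _ lt = contradiction lt (<-irrefl refl)
  adj-sym x i j | tri> _ _ lt = sym (adj-query x lt)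

  graph⁻ : ∀ cs p q → adj (graph cs) p q ≡ true → Adj cs p q
  graph⁻ cs p q eq with Fin.<-cmp p q
  graph⁻ cs p q eq | tri< _ _ _ with adj? cs p q
  ... | yes l = l
  graph⁻ cs p q eq | tri> _ _ _ with adj? cs q p
  ... | yes l = Adj-sym l

  -- `adj` is false on the diagonal whatever the input, hence the hypothesis `p ≢ q`.
  graph⁺ : ∀ cs p q → p ≢ q → Adj cs p q → adj (graph cs) p q ≡ true
  graph⁺ cs p q p≢q l with Fin.<-cmp p q
  ... | tri≈ _ p≡q _ = contradiction p≡q p≢q
  ... | tri< _ _ _ with adj? cs p q
  ...   | yes _ = refl
  ...   | no ¬l = contradiction l ¬l
  graph⁺ cs p q p≢q l | tri> _ _ _ with adj? cs q p
  ...   | yes _ = refl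
  ...   | no ¬l = contradiction (Adj-sym l) ¬l

  -- The tabulation of `cs` is the required bijection: injective by uniqueness, surjective because
  -- `k * m ≡ n` distinct vertices exhaust `Fin n`. The bound `2 ≤ m` keeps consecutive positions
  -- distinct, so no edge falls on the diagonal.
  graph-isCycleUnion : ∀ {k m} cs → 2 ≤ m → k * m ≡ n → CycleSystem k m cs → IsCycleUnion n k m (graph cs)
  graph-isCycleUnion {k} {m} cs 2≤m km≡n sys with tabulation cs (count sys) (sizes sys)
  ... | g , refl =
    mk⤖ {to = λ (a , t) → g a t} ((λ eq → let a≡b , t≡s = inj eq in cong₂ _,_ a≡b t≡s) ,
                                   strictlySurjective⇒surjective surj) ,
    λ a t b s → mk⇔ (to a t b s) (from a t b s)
    where
    cs′ = tabulate (λ a → tabulate (g a))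

    inj : ∀ {a t b s} → g a t ≡ g b s → a ≡ b × t ≡ s
    inj = tabulation-injective g (unique sys)

    surj : ∀ y → ∃[ at ] g (proj₁ at) (proj₂ at) ≡ y
    surj y with Any.tabulate⁻ (Any.concat⁻ cs′
      (Unique-covers (concat cs′) (unique sys)
        (≡.trans (length-concat cs′ (sizes sys)) (≡.trans (cong (_* m) (count sys)) km≡n)) y))
    ... | a , y∈ with ∈-tabulate⁻ y∈
    ...   | t , y≡ = (a , t) , sym y≡

    to : ∀ a t b s → adj (graph cs′) (g a t) (g b s) ≡ true → a ≡ b × Consec m t s
    to a t b s eq with Any.tabulate⁻ (graph⁻ cs′ _ _ eq)
    ... | a′ , l with Link-tabulate (g a′) l
    ...   | t′ , s′ , p≡ , q≡ , con with inj p≡ | inj q≡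
    ...     | refl , refl | refl , refl = refl , con

    from : ∀ a t b s → a ≡ b × Consec m t s → adj (graph cs′) (g a t) (g b s) ≡ true
    from a t .a s (refl , con) = graph⁺ cs′ _ _ (distinct con ∘ proj₂ ∘ inj) (Any.tabulate⁺ a (link con))
      where
      distinct : Consec m t s → t ≢ s
      distinct (inj₁ eq) refl = nextMod-≢ 2≤m eq
      distinct (inj₂ eq) refl = nextMod-≢ 2≤m eq
      link : Consec m t s → Link (tabulate (g a)) (g a t) (g a s)
      link (inj₁ eq) = inj₁ (∈-cyc-tabulate⁺ (g a) t s eq)
      link (inj₂ eq) = inj₂ (∈-cyc-tabulate⁺ (g a) s t eq)

-- The starting position: consecutive blocks of vertices read as cycles

chunks : ∀ {A : Set} → ℕ → ℕ → List A → List (List A)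
chunks zero    m xs = []
chunks (suc k) m xs = take m xs ∷ chunks k m (drop m xs)

module _ {A : Set} {m : ℕ} where

  private
    length-rest : ∀ k (xs : List A) → length xs ≡ suc k * m → length (drop m xs) ≡ k * m
    length-rest k xs eq = ≡.trans (length-drop m xs) (≡.trans (cong (_∸ m) eq) (m+n∸m≡n m (k * m)))

  length-chunks : ∀ k (xs : List A) → length (chunks k m xs) ≡ k
  length-chunks zero    xs = refl
  length-chunks (suc k) xs = cong suc (length-chunks k (drop m xs))

  chunks-sizes : ∀ k (xs : List A) → length xs ≡ k * m → All (λ c → length c ≡ m) (chunks k m xs)
  chunks-sizes zero    xs eq = []
  chunks-sizes (suc k) xs eq =
    ≡.trans (length-take m xs) (m≤n⇒m⊓n≡m (≤-trans (m≤m+n m (k * m)) (≤-reflexive (sym eq)))) ∷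
    chunks-sizes k (drop m xs) (length-rest k xs eq)

  concat-chunks : ∀ k (xs : List A) → length xs ≡ k * m → concat (chunks k m xs) ≡ xs
  concat-chunks zero    []  eq = refl
  concat-chunks (suc k) xs eq = ≡.trans
    (cong (take m xs ++_) (concat-chunks k (drop m xs) (length-rest k xs eq))) (take++drop≡id m xs)

  chunks-system : ∀ k (xs : List A) → Unique xs → length xs ≡ k * m → CycleSystem k m (chunks k m xs)
  chunks-system k xs u eq = record
    { count  = length-chunks k xs
    ; sizes  = chunks-sizes k xs eq
    ; unique = subst Unique (sym (concat-chunks k xs eq)) u }

-- The adversary

-- Here `a` and `b` are the degrees of `u` and `v` before uv is forbidden, which adds at most 2 to
-- each. The `h` heavy vertices count twice, as possible first and second ends, and `l` is the
-- number of cycle edges other than uv.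
switch-count : ∀ {m} a b h l → 4 * a < m → 4 * b < m → 16 * h < m → 12 ≤ m → suc l ≡ m →
  (2 + a) + (2 + b) + (h + h) < l
switch-count a b h l la lb lh 12≤m refl = *-cancelˡ-< 16 _ _ (+-cancelˡ-< 26 _ _ (begin-strict
  26 + 16 * ((2 + a) + (2 + b) + (h + h))
    ≡⟨ eq₁ a b h ⟩
  80 + (4 * suc (4 * a) + 4 * suc (4 * b) + (suc (16 * h) + suc (16 * h)))
    ≤⟨ +-monoʳ-≤ 80 (+-mono-≤ (+-mono-≤ (*-monoʳ-≤ 4 la) (*-monoʳ-≤ 4 lb)) (+-mono-≤ lh lh)) ⟩
  80 + (4 * m + 4 * m + (m + m))
    -- `12 ≤ m` enters here: 9 + 6 * 12 = 81 exceeds 80.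
    <⟨ +-monoˡ-< (4 * m + 4 * m + (m + m)) (+-monoʳ-≤ 9 (*-monoʳ-≤ 6 12≤m)) ⟩
  (9 + 6 * m) + (4 * m + 4 * m + (m + m))
    ≤⟨ ≤-trans (n≤1+n _) (≤-reflexive (eq₂ l)) ⟩
  26 + 16 * l ∎))
  where
  open ≤-Reasoning
  m = suc l
  eq₁ : ∀ a b h → 26 + 16 * ((2 + a) + (2 + b) + (h + h)) ≡
                  80 + (4 * suc (4 * a) + 4 * suc (4 * b) + (suc (16 * h) + suc (16 * h)))
  eq₁ = solve-∀
  eq₂ : ∀ l → suc ((9 + 6 * suc l) + (4 * suc l + 4 * suc l + (suc l + suc l))) ≡ 26 + 16 * l
  eq₂ = solve-∀

-- The blockers amount to less than m/4 + m/4 + 2(m/16), which is 5m/8.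
merge-count : ∀ {m} a b h → 4 * a < m → 4 * b < m → 16 * h < m → a + b + (h + h) < m
merge-count {m} a b h la lb lh = *-cancelˡ-< 16 _ _ (begin-strict
  16 * (a + b + (h + h))
    ≡⟨ eq₁ a b h ⟩
  4 * (4 * a) + 4 * (4 * b) + (16 * h + 16 * h)
    <⟨ +-mono-≤-< (+-mono-≤ (*-monoʳ-≤ 4 (<⇒≤ la)) (*-monoʳ-≤ 4 (<⇒≤ lb))) (+-mono-< lh lh) ⟩
  4 * m + 4 * m + (m + m)
    ≤⟨ m≤m+n _ (6 * m) ⟩
  (4 * m + 4 * m + (m + m)) + 6 * m
    ≡⟨ eq₂ m ⟩
  16 * m ∎)
  where
  open ≤-Reasoning
  eq₁ : ∀ a b h → 16 * (a + b + (h + h)) ≡ 4 * (4 * a) + 4 * (4 * b) + (16 * h + 16 * h)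
  eq₁ = solve-∀
  eq₂ : ∀ m → (4 * m + 4 * m + (m + m)) + 6 * m ≡ 16 * m
  eq₂ = solve-∀

module Adversary (n m : ℕ) where

  V : Set
  V = Fin n

  -- Degrees in the forbidden set and heavy vertices

  nbs : List (V × V) → V → List V
  nbs []            w = []
  nbs ((p , q) ∷ F) w with p Fin.≟ w
  ... | yes _ = q ∷ nbs F w
  ... | no  _ = nbs F w

  -- A repeated query is recorded in `F` again, so the degree counts entries with multiplicity, in
  -- agreement with `length F`.
  deg : List (V × V) → V → ℕ
  deg F w = length (nbs F w)

  ∈-nbs : ∀ F {w q} → (w , q) ∈ F → q ∈ nbs F w
  ∈-nbs ((p , q) ∷ F) {w} (here refl) with p Fin.≟ w
  ... | yes _  = here refl
  ... | no p≢p = contradiction refl p≢p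
  ∈-nbs ((p , q) ∷ F) {w} (there e) with p Fin.≟ w
  ... | yes _ = there (∈-nbs F e)
  ... | no  _ = ∈-nbs F e

  deg-≤-∷ : ∀ e F w → deg F w ≤ deg (e ∷ F) w
  deg-≤-∷ (p , q) F w with p Fin.≟ w
  ... | yes _ = n≤1+n _
  ... | no  _ = ≤-refl

  deg-∷-≤ : ∀ e F w → deg (e ∷ F) w ≤ suc (deg F w)
  deg-∷-≤ (p , q) F w with p Fin.≟ w
  ... | yes _ = ≤-refl
  ... | no  _ = n≤1+n _

  sum-deg-∷-∉ : ∀ p q F ws → p ∉ ws → sum (map (deg ((p , q) ∷ F)) ws) ≡ sum (map (deg F) ws)
  sum-deg-∷-∉ p q F []       _   = refl
  sum-deg-∷-∉ p q F (w ∷ ws) p∉ with p Fin.≟ w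
  ... | yes p≡w = contradiction (here p≡w) p∉
  ... | no  _   = cong (deg F w +_) (sum-deg-∷-∉ p q F ws (p∉ ∘ there))

  sum-deg-∷ : ∀ p q F ws → Unique ws → sum (map (deg ((p , q) ∷ F)) ws) ≤ suc (sum (map (deg F) ws))
  sum-deg-∷ p q F []       _        = z≤n
  sum-deg-∷ p q F (w ∷ ws) (w∉ ∷ u) with p Fin.≟ w
  ... | yes refl = ≤-reflexive (cong (λ s → suc (deg F w + s))
                     (sum-deg-∷-∉ p q F ws (λ p∈ → All.lookup w∉ p∈ refl)))
  ... | no  _    = ≤-trans (+-monoʳ-≤ (deg F w) (sum-deg-∷ p q F ws u)) (≤-reflexive (+-suc _ _))

  -- An entry of `F` contributes only at its first component, which occurs at most once in `ws`.
  sum-deg : ∀ F ws → Unique ws → sum (map (deg F) ws) ≤ length F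
  sum-deg []            ws u = ≤-reflexive (sum-zeros ws)
    where
    sum-zeros : ∀ ws → sum (map (deg []) ws) ≡ 0
    sum-zeros []       = refl
    sum-zeros (_ ∷ ws) = sum-zeros ws
  sum-deg ((p , q) ∷ F) ws u = ≤-trans (sum-deg-∷ p q F ws u) (s≤s (sum-deg F ws u))

  Heavy : List (V × V) → V → Set
  Heavy F w = m ≤ 4 * deg F w

  heavy? : ∀ F w → Dec (Heavy F w)
  heavy? F w = m ≤? 4 * deg F w

  hubs : List (V × V) → List V
  hubs F = filter (heavy? F) (allFin n)

  ∉-hubs : ∀ F {w} → w ∉ hubs F → ¬ Heavy F w
  ∉-hubs F {w} w∉ h = w∉ (∈-filter⁺ (heavy? F) (∈-allFin w) h)

  heavy-sum : ∀ F ws → All (Heavy F) ws → m * length ws ≤ 4 * sum (map (deg F) ws)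
  heavy-sum F []       []       = ≤-trans (≤-reflexive (*-zeroʳ m)) z≤n
  heavy-sum F (w ∷ ws) (h ∷ hs) = begin
    m * suc (length ws)                        ≡⟨ *-suc m _ ⟩
    m + m * length ws                          ≤⟨ +-mono-≤ h (heavy-sum F ws hs) ⟩
    4 * deg F w + 4 * sum (map (deg F) ws)     ≡⟨ *-distribˡ-+ 4 (deg F w) _ ⟨
    4 * (deg F w + sum (map (deg F) ws))       ∎
    where open ≤-Reasoning

  -- Double counting: every heavy vertex contributes at least m/4 to a degree sum of at most
  -- `length F`, so m times the number of hubs is at most `4 * length F`, which is below m²/16.
  hubs-bound : ∀ F → 64 * length F < m * m → 16 * length (hubs F) < m
  hubs-bound F small = *-cancelˡ-< m _ _ (begin-strict
    m * (16 * H)     ≡⟨ lem m H ⟩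
    16 * (m * H)     ≤⟨ *-monoʳ-≤ 16 (heavy-sum F (hubs F) (All.all-filter (heavy? F) (allFin n))) ⟩
    16 * (4 * sum (map (deg F) (hubs F)))
      ≤⟨ *-monoʳ-≤ 16 (*-monoʳ-≤ 4 (sum-deg F (hubs F) (Unique.filter⁺ (heavy? F) (Unique.allFin⁺ n)))) ⟩
    16 * (4 * length F) ≡⟨ *-assoc 16 4 (length F) ⟨
    64 * length F    <⟨ small ⟩
    m * m            ∎)
    where
    open ≤-Reasoning
    H = length (hubs F)
    lem : ∀ m h → m * (16 * h) ≡ 16 * (m * h)
    lem = solve-∀

  -- The left summand holds vertices barred as first end of an edge, the right one those barred as
  -- second end. With the roles kept apart, a blocker hits at most one edge of a path or cycle.
  Clash : V × V → V ⊎ V → Set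
  Clash (a , b) (inj₁ w) = a ≡ w
  Clash (a , b) (inj₂ w) = b ≡ w

  clash? : ∀ e w → Dec (Clash e w)
  clash? (a , b) (inj₁ w) = a Fin.≟ w
  clash? (a , b) (inj₂ w) = b Fin.≟ w

  -- The two lists assumed unique are the lists of first ends and of second ends. Both hypotheses
  -- also hold for a closed path, `z` being `x`, so whole cycles are covered.
  path-exclusive : ∀ x ys z → Unique (x ∷ ys) → Unique (ys ++ [ z ]) →
    AllPairs (λ e e′ → ∀ w → Clash e w → ¬ Clash e′ w) (path x ys z)
  path-exclusive x ys z u₁ u₂ = AllPairs.zipWith
    (λ { (f , g) (inj₁ w) refl eq → f (sym eq) ; (f , g) (inj₂ w) refl eq → g (sym eq) })
    ( AllPairs.map⁻ (subst Unique (sym (map-proj₁-path x ys z)) u₁)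
    , AllPairs.map⁻ (subst Unique (sym (map-proj₂-path x ys z)) u₂))

  edge-avoiding : ∀ As Bs x ys z → Unique (x ∷ ys) → Unique (ys ++ [ z ]) →
    length As + length Bs < suc (length ys) →
    ∃₂ λ a b → (a , b) ∈ path x ys z × a ∉ As × b ∉ Bs
  edge-avoiding As Bs x ys z u₁ u₂ lt
    with unblocked clash? (map inj₁ As ++ map inj₂ Bs) (path x ys z) (path-exclusive x ys z u₁ u₂)
           (subst₂ _<_ (sym count-blockers) (sym (length-path x ys z)) lt)
    where
    count-blockers : length (map inj₁ As ++ map inj₂ Bs) ≡ length As + length Bs
    count-blockers = ≡.trans (length-++ (map inj₁ As)) (cong₂ _+_ (length-map inj₁ As) (length-map inj₂ Bs))
  ... | (a , b) , e∈ , free = a , b , e∈ ,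
      (λ a∈ → All.lookup (All.map⁻ (All.++⁻ˡ (map inj₁ As) free)) a∈ refl) ,
      (λ b∈ → All.lookup (All.map⁻ (All.++⁻ʳ (map inj₁ As) free)) b∈ refl)

  -- An edge is unusable only if one of its ends lies in a list of heavy vertices and
  -- F-neighbours, and each vertex is the first (second) end of at most one edge of a path.
  light-edge : ∀ F u v x ys z → Unique (x ∷ ys) → Unique (ys ++ [ z ]) →
    deg F u + deg F v + (length (hubs F) + length (hubs F)) < suc (length ys) →
    ∃₂ λ a b → (a , b) ∈ path x ys z × ¬ Heavy F a × ¬ Heavy F b × (u , a) ∉ F × (v , b) ∉ F
  light-edge F u v x ys z u₁ u₂ lt =
    let a , b , e∈ , a∉ , b∉ = edge-avoiding (hubs F ++ nbs F u) (hubs F ++ nbs F v) x ys z u₁ u₂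
                                 (subst (_< suc (length ys)) (sym total) lt)
    in  a , b , e∈ , ∉-hubs F (a∉ ∘ ∈-++⁺ˡ) , ∉-hubs F (b∉ ∘ ∈-++⁺ˡ) ,
        a∉ ∘ ∈-++⁺ʳ (hubs F) ∘ ∈-nbs F , b∉ ∘ ∈-++⁺ʳ (hubs F) ∘ ∈-nbs F
    where
    rearrange : ∀ h a b → (h + a) + (h + b) ≡ a + b + (h + h)
    rearrange = solve-∀
    total : length (hubs F ++ nbs F u) + length (hubs F ++ nbs F v) ≡
            deg F u + deg F v + (length (hubs F) + length (hubs F))
    total = ≡.trans (cong₂ _+_ (length-++ (hubs F)) (length-++ (hubs F)))
                    (rearrange (length (hubs F)) (deg F u) (deg F v))

  -- Invariants of a position and the switching step

  Symmetric : List (V × V) → Set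
  Symmetric F = ∀ {p q} → (p , q) ∈ F → (q , p) ∈ F

  Avoids : List (V × V) → List (List V) → Set
  Avoids F cs = ∀ {p q} → Adj cs p q → (p , q) ∉ F

  -- Since `Adj` is symmetric, asking for a heavy first end covers edges that are heavy at either
  -- end.
  Keeps : List (V × V) → List (List V) → List (List V) → Set
  Keeps F cs cs′ = ∀ {p q} → Heavy F p → Adj cs p q → Adj cs′ p q

  -- F holds each forbidden pair in both orders, so the bound of m²/128 queries
  -- becomes 64 * length F < m * m.
  forbid : V → V → List (V × V) → List (V × V)
  forbid u v F = (u , v) ∷ (v , u) ∷ F

  forbid-symmetric : ∀ {u v F} → Symmetric F → Symmetric (forbid u v F)
  forbid-symmetric s (here refl)         = there (here refl)
  forbid-symmetric s (there (here refl)) = here refl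
  forbid-symmetric s (there (there e))   = there (there (s e))

  ∉-forbid : ∀ {u v p q F} → ¬ Same p q u v → (p , q) ∉ F → (p , q) ∉ forbid u v F
  ∉-forbid ¬s ∉F (here refl)         = ¬s (inj₁ (refl , refl))
  ∉-forbid ¬s ∉F (there (here refl)) = ¬s (inj₂ (refl , refl))
  ∉-forbid ¬s ∉F (there (there e))   = ∉F e

  deg-forbid-≥ : ∀ u v F w → deg F w ≤ deg (forbid u v F) w
  deg-forbid-≥ u v F w = ≤-trans (deg-≤-∷ (v , u) F w) (deg-≤-∷ (u , v) _ w)

  deg-forbid-≤ : ∀ u v F w → deg (forbid u v F) w ≤ 2 + deg F w
  deg-forbid-≤ u v F w = ≤-trans (deg-∷-≤ (u , v) _ w) (s≤s (deg-∷-≤ (v , u) F w))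

  heavy-mono : ∀ {F F′ w} → deg F w ≤ deg F′ w → Heavy F w → Heavy F′ w
  heavy-mono d h = ≤-trans h (*-monoʳ-≤ 4 d)

  ∉-Same : ∀ {F p q u v} → Symmetric F → (u , v) ∉ F → Same p q u v → (p , q) ∉ F
  ∉-Same s ∉F (inj₁ (refl , refl)) = ∉F
  ∉-Same s ∉F (inj₂ (refl , refl)) = ∉F ∘ s

  ¬heavy-Same : ∀ {F p q u v} → ¬ Heavy F u → ¬ Heavy F v → Same p q u v → ¬ Heavy F p
  ¬heavy-Same ¬u ¬v (inj₁ (refl , _)) = ¬u
  ¬heavy-Same ¬u ¬v (inj₂ (refl , _)) = ¬v

  cyc-unique : ∀ {x : V} xs → Unique (x ∷ xs) → Unique (xs ++ [ x ])
  cyc-unique {x} xs = Unique-resp-↭ (∷↭∷ʳ x xs)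

  module _ {k : ℕ} {F : List (V × V)} {cs rest : List (List V)} {c : List V} {u v a b : V}
    (ys zs : List V)
    (sys : CycleSystem k m cs) (symF : Symmetric F) (av : Avoids F cs)
    (σ : cs ↭ c ∷ rest) (c↭ : c ↭ u ∷ v ∷ ys ++ a ∷ b ∷ zs)
    (cyc↭ : cyc c ↭ cyc (u ∷ v ∷ ys ++ a ∷ b ∷ zs))
    where

    private
      c′ : List V
      c′ = switch {u = u} {v} {a} {b} ys zs
      c′↭c : c′ ↭ c
      c′↭c = ↭-trans (switch-↭ ys zs) (↭-sym c↭)
      uniq : Unique (c ++ concat rest)
      uniq = Unique-resp-↭ (concat-↭ σ) (unique sys)
      uniq-c : Unique (u ∷ v ∷ ys ++ a ∷ b ∷ zs)
      uniq-c = Unique-resp-↭ c↭ (proj₁ (Unique-++⁻ c uniq))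
      symF′ : Symmetric (forbid u v F)
      symF′ = forbid-symmetric symF

    switched-system : CycleSystem k m (c′ ∷ rest)
    switched-system with All-resp-↭ σ (sizes sys)
    ... | len-c ∷ lens = record
      { count  = ≡.trans (sym (↭-length σ)) (count sys)
      ; sizes  = ≡.trans (↭-length c′↭c) len-c ∷ lens
      ; unique = Unique-resp-↭ (↭-sym (++⁺ʳ (concat rest) c′↭c)) uniq }

    -- Besides the two new edges, chosen outside the enlarged set, only old edges remain. They were
    -- not in `F`, and none of them is uv: by `switch-new` on the switched cycle, by disjointness
    -- from `u` on the others.
    switched-avoids : (u , a) ∉ forbid u v F → (v , b) ∉ forbid u v F →
                      Avoids (forbid u v F) (c′ ∷ rest)
    switched-avoids ua∉ vb∉ (here l) with switch-new ys zs uniq-c l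
    ... | inj₁ (l′ , ¬s) = ∉-forbid ¬s
      (av (Any-resp-↭ (↭-sym σ) (here (Link-resp-↭ (u ∷ v ∷ ys ++ a ∷ b ∷ zs) c (↭-sym cyc↭) l′))))
    ... | inj₂ (inj₁ s)  = ∉-Same symF′ ua∉ s
    ... | inj₂ (inj₂ s)  = ∉-Same symF′ vb∉ s
    switched-avoids _ _ (there l) = ∉-forbid
      (λ { (inj₁ (refl , _)) → u∉rest (proj₁ (Adj-ends l))
         ; (inj₂ (_ , refl)) → u∉rest (proj₂ (Adj-ends l)) })
      (av (Any-resp-↭ (↭-sym σ) (there l)))
      where
      u∉rest : u ∉ concat rest
      u∉rest = proj₂ (proj₂ (Unique-++⁻ c uniq)) (∈-resp-↭ (↭-sym c↭) (here refl))

    switched-keeps : ¬ Heavy F u → ¬ Heavy F v → ¬ Heavy F a → ¬ Heavy F b → Keeps F cs (c′ ∷ rest)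
    switched-keeps ¬hu ¬hv ¬ha ¬hb h l with Any-resp-↭ σ l
    ... | there l′ = there l′
    ... | here l′ with switch-keeps ys zs (Link-resp-↭ c (u ∷ v ∷ ys ++ a ∷ b ∷ zs) cyc↭ l′)
    ...   | inj₁ l″        = here l″
    ...   | inj₂ (inj₁ s) = contradiction h (¬heavy-Same {F} ¬hu ¬hv s)
    ...   | inj₂ (inj₂ s) = contradiction h (¬heavy-Same {F} ¬ha ¬hb s)

  -- The edge ab is sought with uv already forbidden: this excludes a = v and b = u,
  -- where the switch would leave uv in place.
  switch-step : ∀ {k F cs u v} → 12 ≤ m → CycleSystem k m cs → Symmetric F → Avoids F cs →
    64 * (2 + length F) < m * m →
    Any (λ c → (u , v) ∈ cyc c) cs → ¬ Heavy F u → ¬ Heavy F v →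
    ∃[ cs′ ] CycleSystem k m cs′ × Avoids (forbid u v F) cs′ × Keeps F cs cs′
  switch-step {k} {F} {cs} {u} {v} 12≤m sys symF av small e ¬hu ¬hv =
    case find e of λ { (c , c∈ , e∈) →
    case ∈-∃++ c∈ of λ { (cs₁ , cs₂ , cs≡) →
    let σ     = ↭-trans (↭-reflexive cs≡) (shift c cs₁ cs₂)
        len-c = All.lookup (sizes sys) c∈
    in
    case ∈-cyc-rotate c (≤-trans (s≤s (s≤s z≤n)) (≤-trans 12≤m (≤-reflexive (sym len-c)))) e∈
      of λ { (xs , c↭ , cyc↭) →
    let uniq-c = Unique-resp-↭ c↭ (proj₁ (Unique-++⁻ c (Unique-resp-↭ (concat-↭ σ) (unique sys))))
        -- Lightness of `u` and `v` is known for `F`, whereas the hubs are those of `F′`;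
        -- `deg-forbid-≤` bridges the gap. The candidates for ab are the `suc (length xs)` edges of
        -- the path from `v` back to `u`.
        few    = switch-count (deg F u) (deg F v) (length (hubs F′)) (suc (length xs))
                   (≰⇒> ¬hu) (≰⇒> ¬hv) (hubs-bound F′ small) 12≤m (≡.trans (sym (↭-length c↭)) len-c)
    in
    case light-edge F′ u v v xs u (AllPairs.tail uniq-c) (AllPairs.tail (cyc-unique (v ∷ xs) uniq-c))
           (≤-<-trans (+-monoˡ-≤ _ (+-mono-≤ (deg-forbid-≤ u v F u) (deg-forbid-≤ u v F v))) few)
      of λ { (a , b , ab∈ , ¬ha , ¬hb , ua∉ , vb∉) →
    case ∈-path-inner xs ab∈ (λ a≡v → ua∉ (here (cong (u ,_) a≡v)))
                             (λ b≡u → vb∉ (there (here (cong (v ,_) b≡u))))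
      of λ { (ys , zs , refl) →
      _ , switched-system ys zs sys symF av σ c↭ cyc↭ ,
      (λ {p} {q} → switched-avoids ys zs sys symF av σ c↭ cyc↭ ua∉ vb∉ {p} {q}) ,
      (λ {p} {q} → switched-keeps {F = F} ys zs sys symF av σ c↭ cyc↭
                     ¬hu ¬hv (light ¬ha) (light ¬hb) {p} {q}) }}}}}
    where
    F′ : List (V × V)
    F′ = forbid u v F

    light : ∀ {w} → ¬ Heavy (forbid u v F) w → ¬ Heavy F w
    light {w} ¬h h = ¬h (heavy-mono {F} {forbid u v F} (deg-forbid-≥ u v F w) h)

  -- Merging the cycles into a Hamiltonian cycle

  module _ {F : List (V × V)} {c d : List V} {u v a b : V} (xs ys : List V) (symF : Symmetric F)
    (cyc-c : cyc c ↭ cyc (u ∷ v ∷ xs)) (cyc-d : cyc d ↭ cyc (a ∷ b ∷ ys))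
    where

    private
      c′ : List V
      c′ = merge {u = u} {v} {a} {b} xs ys

    merged-avoids : Avoids F (c ∷ [ d ]) → (v , a) ∉ F → (u , b) ∉ F → Avoids F [ c′ ]
    merged-avoids av va∉ ub∉ (here l) with merge-new xs ys l
    ... | inj₁ l′               = av (here (Link-resp-↭ (u ∷ v ∷ xs) c (↭-sym cyc-c) l′))
    ... | inj₂ (inj₁ l′)        = av (there (here (Link-resp-↭ (a ∷ b ∷ ys) d (↭-sym cyc-d) l′)))
    ... | inj₂ (inj₂ (inj₁ s)) = ∉-Same symF ub∉ s
    ... | inj₂ (inj₂ (inj₂ s)) = ∉-Same symF va∉ s

    merged-keeps : ¬ Heavy F u → ¬ Heavy F v → ¬ Heavy F a → ¬ Heavy F b →
                   Keeps F (c ∷ [ d ]) [ c′ ]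
    merged-keeps ¬hu ¬hv ¬ha ¬hb h (here l)
      with merge-keeps₁ xs ys (Link-resp-↭ c (u ∷ v ∷ xs) cyc-c l)
    ... | inj₁ l′ = here l′
    ... | inj₂ s  = contradiction h (¬heavy-Same {F} ¬hu ¬hv s)
    merged-keeps ¬hu ¬hv ¬ha ¬hb h (there (here l))
      with merge-keeps₂ xs ys (Link-resp-↭ d (a ∷ b ∷ ys) cyc-d l)
    ... | inj₁ l′ = here l′
    ... | inj₂ s  = contradiction h (¬heavy-Same {F} ¬ha ¬hb s)

  -- An edge uv with light ends is fixed on `c` first, and then an edge ab on `d` suited to it. Only
  -- `m ≤ length c` is asked, as `c` may result from earlier merges.
  merge-step : ∀ {F} c d → 2 ≤ m → Symmetric F → 64 * length F < m * m →
    m ≤ length c → length d ≡ m → Unique (c ++ d) → Avoids F (c ∷ [ d ]) →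
    ∃[ c′ ] c′ ↭ c ++ d × Avoids F [ c′ ] × Keeps F (c ∷ [ d ]) [ c′ ]
  merge-step []       _        2≤m _ _ m≤ _ _ _ = contradiction (≤-trans 2≤m m≤) λ ()
  merge-step (_ ∷ _)  []       2≤m _ _ _  d≡ _ _ = contradiction (≤-trans 2≤m (≤-reflexive (sym d≡))) λ ()
  merge-step {F} (x ∷ xs) (y ∷ ys) 2≤m symF small m≤ d≡ uniq av =
    case Unique-++⁻ (x ∷ xs) uniq of λ { (uc , ud , _) →
    case edge-avoiding (hubs F) (hubs F) x xs x uc (cyc-unique xs uc)
           -- On `c` only heavy vertices are barred, hence the two zeros in place of degrees.
           (<-≤-trans (merge-count 0 0 (length (hubs F)) 0<m 0<m few) m≤)
      of λ { (u , v , uv∈ , u∉ , v∉) →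
    -- The order `v u` reflects that merging joins `v` to `a` and `u` to `b`.
    case light-edge F v u y ys y ud (cyc-unique ys ud)
           (<-≤-trans (merge-count (deg F v) (deg F u) (length (hubs F))
                         (≰⇒> (∉-hubs F v∉)) (≰⇒> (∉-hubs F u∉)) few)
                      (≤-reflexive (sym d≡)))
      of λ { (a , b , ab∈ , ¬ha , ¬hb , va∉ , ub∉) →
    case ∈-cyc-rotate (x ∷ xs) (≤-trans 2≤m m≤) uv∈ of λ { (xs′ , c↭ , cyc-c) →
    case ∈-cyc-rotate (y ∷ ys) (≤-trans 2≤m (≤-reflexive (sym d≡))) ab∈ of λ { (ys′ , d↭ , cyc-d) →
      merge {u = u} {v} {a} {b} xs′ ys′ ,
      ↭-trans (merge-↭ xs′ ys′) (++⁺ (↭-sym c↭) (↭-sym d↭)) ,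
      (λ {p} {q} → merged-avoids {F} {x ∷ xs} {y ∷ ys} xs′ ys′ symF cyc-c cyc-d av va∉ ub∉ {p} {q}) ,
      (λ {p} {q} → merged-keeps {F} {x ∷ xs} {y ∷ ys} xs′ ys′ symF cyc-c cyc-d
        (∉-hubs F u∉) (∉-hubs F v∉) ¬ha ¬hb {p} {q}) }}}}}
    where
    0<m : 0 < m
    0<m = ≤-trans (s≤s z≤n) 2≤m
    few : 16 * length (hubs F) < m
    few = hubs-bound F small

  -- The first cycle absorbs the others one at a time. `F` stays fixed, so heaviness does not change
  -- and the `Keeps` properties compose.
  merge-all : ∀ {F} → 2 ≤ m → Symmetric F → 64 * length F < m * m →
    ∀ c cs → m ≤ length c → All (λ d → length d ≡ m) cs → Unique (c ++ concat cs) →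
    Avoids F (c ∷ cs) →
    ∃[ c′ ] c′ ↭ c ++ concat cs × Avoids F [ c′ ] × Keeps F (c ∷ cs) [ c′ ]
  merge-all 2≤m symF small c [] _ _ _ av = c , ↭-reflexive (sym (++-identityʳ c)) , av , λ _ l → l
  merge-all {F} 2≤m symF small c (d ∷ ds) m≤ (d≡ ∷ ds≡) uniq av =
    case merge-step {F} c d 2≤m symF small m≤ d≡
           (proj₁ (Unique-++⁻ (c ++ d) (subst Unique (sym (++-assoc c d (concat ds))) uniq)))
           (λ { (here l) → av (here l) ; (there (here l)) → av (there (here l)) })
      of λ { (c₁ , c₁↭ , av₁ , keeps₁) →
    let all↭ = ↭-trans (++⁺ʳ (concat ds) c₁↭) (↭-reflexive (++-assoc c d (concat ds))) in
    case merge-all {F} 2≤m symF small c₁ ds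
           (≤-trans m≤ (≤-trans (m≤m+n _ (length d)) (≤-reflexive (sym (≡.trans (↭-length c₁↭) (length-++ c))))))
           ds≡ (Unique-resp-↭ (↭-sym all↭) uniq)
           (λ { (here l) → av₁ (here l) ; (there l) → av (there (there l)) })
      of λ { (c′ , c′↭ , av′ , keeps′) →
      c′ , ↭-trans c′↭ all↭ , (λ {p} {q} → av′ {p} {q}) , λ {p} {q} →
      λ { h (here l)          → keeps′ h (widen (keeps₁ h (here l)))
        ; h (there (here l))  → keeps′ h (widen (keeps₁ h (there (here l))))
        ; h (there (there l)) → keeps′ h (there l) } }}
    where
    widen : ∀ {c₁ p q} → Adj [ c₁ ] p q → Adj (c₁ ∷ ds) p q
    widen (here l) = here l

  -- Playing the adversary against a decision tree

  Consistent : Input n → List (V × V) → List (List V) → Set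
  Consistent x F cs = (∀ {p q} → (p , q) ∈ F → adj x p q ≡ false) ×
                      (∀ {p q} → Heavy F p → Adj cs p q → adj x p q ≡ true)

  -- In the final position all 0-answers lie in `F′` and all 1-answers on edges of `cs′` with a
  -- heavy end, so every `Consistent` input follows the same branch. The fields `extends`, `grows`
  -- and `keeps` transport an answer given at the present node to that position.
  record Outcome (k : ℕ) (T : DTree (Pair n)) (F : List (V × V)) (cs : List (List V)) : Set where
    field
      {F′}     : List (V × V)
      {cs′}    : List (List V)
      isSystem : CycleSystem k m cs′
      symm     : Symmetric F′
      avoids   : Avoids F′ cs′
      small    : 64 * length F′ < m * m
      extends  : ∀ {e} → e ∈ F → e ∈ F′
      grows    : ∀ w → deg F w ≤ deg F′ w
      keeps    : Keeps F cs cs′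
      answer   : Bool
      decided  : ∀ x → Consistent x F′ cs′ → eval T x ≡ answer

  module _ {k : ℕ} {F : List (V × V)} {cs : List (List V)} {i j : V} {i<j : i Fin.< j}
    {T₀ T₁ : DTree (Pair n)}
    where

    -- `Same` reconciles the order of the query, `i < j`, with the direction in which the cycle
    -- traverses the edge.
    answer-no : ∀ {u v cs₁} → Same i j u v → Keeps F cs cs₁ →
      Outcome k T₀ (forbid u v F) cs₁ → Outcome k (node (i , j , i<j) T₀ T₁) F cs
    answer-no {u} {v} same keeps₁ o = record
      { isSystem = isSystem ; symm = symm ; avoids = avoids ; small = small
      ; extends = λ e → extends (there (there e))
      ; grows   = λ w → ≤-trans (deg-forbid-≥ u v F w) (grows w)
      ; keeps   = λ {p} h l → keeps (heavy-mono {F} {forbid u v F} (deg-forbid-≥ u v F p) h) (keeps₁ h l)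
      ; answer  = answer
      ; decided = λ x con → ≡.trans
          (cong (λ b → if b then eval T₁ x else eval T₀ x)
            (≡.trans (sym (adj-query x i<j)) (proj₁ con (queried same))))
          (decided x con) }
      where
      open Outcome o
      queried : Same i j u v → (i , j) ∈ F′
      queried (inj₁ (refl , refl)) = extends (here refl)
      queried (inj₂ (refl , refl)) = extends (there (here refl))

    -- Degrees only grow and edges with a heavy end are kept, so the pair is still such an edge at
    -- the end of play, where consistency forces the bit 1.
    answer-yes : Adj cs i j → Heavy F i ⊎ Heavy F j → Outcome k T₁ F cs →
      Outcome k (node (i , j , i<j) T₀ T₁) F cs
    answer-yes l heavy o = record
      { isSystem = isSystem ; symm = symm ; avoids = avoids ; small = small
      ; extends = extends ; grows = grows ; keeps = keeps ; answer = answer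
      ; decided = λ x con → ≡.trans
          (cong (λ b → if b then eval T₁ x else eval T₀ x)
            (≡.trans (sym (adj-query x i<j)) (present x con heavy)))
          (decided x con) }
      where
      open Outcome o
      present : ∀ x → Consistent x F′ cs′ → Heavy F i ⊎ Heavy F j → adj x i j ≡ true
      present x con (inj₁ h) = proj₂ con (heavy-mono {F} {F′} (grows i) h) (keeps h l)
      present x con (inj₂ h) = ≡.trans (adj-sym x i j)
        (proj₂ con (heavy-mono {F} {F′} (grows j) h) (keeps h (Adj-sym l)))

  -- A single pending query already costs 64 * 2 = 128, while `m` at most 11 would give a square of
  -- at most 121.
  budget⇒12≤m : ∀ {l d} → 64 * (l + 2 * suc d) < m * m → 12 ≤ m
  budget⇒12≤m {l} {d} b with 12 ≤? m
  ... | yes 12≤m = 12≤m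
  ... | no  12≰m = contradiction (begin-strict
      121                  ≤⟨ m≤n+m 121 7 ⟩
      64 * 2               ≤⟨ *-monoʳ-≤ 64 (≤-trans (*-monoʳ-≤ 2 (s≤s z≤n)) (m≤n+m (2 * suc d) l)) ⟩
      64 * (l + 2 * suc d) <⟨ b ⟩
      m * m                ≤⟨ *-mono-≤ m≤11 m≤11 ⟩
      121                  ∎) (<-irrefl refl)
    where
    open ≤-Reasoning
    m≤11 : m ≤ 11
    m≤11 = ≤-pred (≰⇒> 12≰m)

  budget-no : ∀ l {d d′} → d ≤ d′ → 64 * (l + 2 * suc d′) < m * m → 64 * (2 + l + 2 * d) < m * m
  budget-no l {d} {d′} d≤ = ≤-<-trans (*-monoʳ-≤ 64
    (≤-trans (+-monoʳ-≤ (2 + l) (*-monoʳ-≤ 2 d≤)) (≤-reflexive (eq l d′))))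
    where
    eq : ∀ l d → 2 + l + 2 * d ≡ l + 2 * suc d
    eq = solve-∀

  budget-yes : ∀ l {d d′} → d ≤ d′ → 64 * (l + 2 * suc d′) < m * m → 64 * (l + 2 * d) < m * m
  budget-yes l d≤ = ≤-<-trans (*-monoʳ-≤ 64 (+-monoʳ-≤ l (*-monoʳ-≤ 2 (m≤n⇒m≤1+n d≤))))

  -- The quantity `length F + 2 * depth T` never increases along the branch: a 0-answer adds two
  -- entries to `F` and lowers the remaining depth by at least one. At the leaf it bounds
  -- `length F`.
  play : ∀ {k} T {F cs} → CycleSystem k m cs → Symmetric F → Avoids F cs →
    64 * (length F + 2 * depth T) < m * m → Outcome k T F cs
  play (leaf b) {F} sys symF av bound = record
    { isSystem = sys ; symm = symF ; avoids = av
    ; small    = ≤-<-trans (*-monoʳ-≤ 64 (m≤m+n (length F) 0)) bound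
    ; extends  = id ; grows = λ _ → ≤-refl ; keeps = λ _ l → l
    ; answer   = b ; decided = λ _ _ → refl }
  play {k} (node (i , j , i<j) T₀ T₁) {F} {cs} sys symF av bound with adj? cs i j
  -- A non-edge is answered 0 with the cycles left as they are.
  ... | no ¬l = answer-no {cs₁ = cs} (inj₁ (refl , refl)) (λ _ l → l)
        (play T₀ sys (forbid-symmetric symF)
          (λ {p} {q} l → ∉-forbid (λ { (inj₁ (refl , refl)) → ¬l l
                                     ; (inj₂ (refl , refl)) → ¬l (Adj-sym l) }) (av l))
          (budget-no (length F) (m≤m⊔n (depth T₀) (depth T₁)) bound))
  ... | yes l with heavy? F i | heavy? F j
  ...   | yes h | _     = answer-yes l (inj₁ h)
          (play T₁ sys symF av (budget-yes (length F) (m≤n⊔m (depth T₀) (depth T₁)) bound))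
  ...   | no _  | yes h = answer-yes l (inj₂ h)
          (play T₁ sys symF av (budget-yes (length F) (m≤n⊔m (depth T₀) (depth T₁)) bound))
  ...   | no ¬hi | no ¬hj = oriented (find l)
    where
    bound₀ : 64 * (2 + length F + 2 * depth T₀) < m * m
    bound₀ = budget-no (length F) (m≤m⊔n (depth T₀) (depth T₁)) bound
    evade : ∀ {u v} → Same i j u v → Any (λ c → (u , v) ∈ cyc c) cs → ¬ Heavy F u → ¬ Heavy F v →
      Outcome k (node (i , j , i<j) T₀ T₁) F cs
    evade same e ¬hu ¬hv =
      case switch-step {F = F} (budget⇒12≤m {length F} bound) sys symF av
             (≤-<-trans (*-monoʳ-≤ 64 (m≤m+n (2 + length F) (2 * depth T₀))) bound₀) e ¬hu ¬hv
        of λ { (cs₁ , sys₁ , av₁ , keeps₁) →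
          answer-no same keeps₁ (play T₀ sys₁ (forbid-symmetric symF) av₁ bound₀) }
    oriented : (∃[ c ] c ∈ cs × Link c i j) → Outcome k (node (i , j , i<j) T₀ T₁) F cs
    oriented (c , c∈ , inj₁ e) = evade (inj₁ (refl , refl)) (lose c∈ e) ¬hi ¬hj
    oriented (c , c∈ , inj₂ e) = evade (inj₂ (refl , refl)) (lose c∈ e) ¬hj ¬hi

  -- Two consistent graphs of opposite value and the depth bound

  Adj-irreflexive : ∀ {k r} {cs : List (List V)} {p q} → 2 ≤ r → CycleSystem k r cs → Adj cs p q → p ≢ q
  Adj-irreflexive {cs = cs} {p} 2≤r sys l refl = case find l of λ { (c , c∈ , l′) →
    case ∈-∃++ c∈ of λ { (cs₁ , cs₂ , cs≡) →
    case ∈-cyc-rotate c {p} {p} (≤-trans 2≤r (≤-reflexive (sym (All.lookup (sizes sys) c∈))))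
           ([ id , id ]′ l′)
      of λ { (xs , c↭ , _) →
    All.lookup (AllPairs.head (Unique-resp-↭ c↭ (proj₁ (Unique-++⁻ c
      (Unique-resp-↭ (concat-↭ (↭-trans (↭-reflexive cs≡) (shift c cs₁ cs₂))) (unique sys))))))
      (here refl) refl }}}

  -- Serves both final graphs: the union of cycles with `cs₀` equal to `cs`, and the Hamiltonian
  -- cycle with `cs₀` the system it was merged from.
  graph-consistent : ∀ {k r F cs} → 2 ≤ r → CycleSystem k r cs → Avoids F cs →
    ∀ {cs₀} → Keeps F cs₀ cs → Consistent (graph cs) F cs₀
  graph-consistent {F = F} {cs} 2≤r sys av keeps =
    (λ {p} {q} e → absent p q e) ,
    (λ {p} {q} h l → graph⁺ cs p q (Adj-irreflexive 2≤r sys (keeps h l)) (keeps h l))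
    where
    absent : ∀ p q → (p , q) ∈ F → adj (graph cs) p q ≡ false
    absent p q e with adj (graph cs) p q in eq
    ... | false = refl
    ... | true  = contradiction e (av (graph⁻ cs p q eq))

  depth-bound : ∀ {k} → 2 ≤ m → suc k * m ≡ n → (T : DTree (Pair n)) →
    (∀ x → IsCycleUnion n 1 n x → eval T x ≡ true) →
    (∀ x → IsCycleUnion n (suc k) m x → eval T x ≡ false) →
    m * m ≤ 128 * depth T
  depth-bound {k} 2≤m km≡n T yes-on-1 no-on-k = ≮⇒≥ λ 128d<m² →
    absurd (play T
      (chunks-system (suc k) (allFin n) (Unique.allFin⁺ n) (≡.trans (length-tabulate id) (sym km≡n)))
      -- For empty `F` the budget is `64 * (2 * depth T) < m * m`, the negation of the claim.
      (λ ()) (λ _ ()) (subst (_< m * m) (*-assoc 64 2 (depth T)) 128d<m²))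
    where
    absurd : ¬ Outcome (suc k) T [] (chunks (suc k) m (allFin n))
    absurd o = conflict cs′ isSystem avoids decided
      where
      open Outcome o
      -- The final system is generalised to a variable, so that a first cycle can be split off to
      -- absorb the rest.
      conflict : ∀ cs → CycleSystem (suc k) m cs → Avoids F′ cs →
                 ¬ (∀ x → Consistent x F′ cs → eval T x ≡ answer)
      conflict []       (system () _ _)
      conflict (c ∷ cs) sys@(system cnt (c≡ ∷ cs≡) uniq) av dec =
        case merge-all 2≤m symm small c cs (≤-reflexive (sym c≡)) cs≡ uniq av
          of λ { (c′ , c′↭ , av′ , keeps′) →
          let len  = ≡.trans (↭-length c′↭) (≡.trans (length-concat (c ∷ cs) (c≡ ∷ cs≡))
                       (≡.trans (cong (_* m) cnt) km≡n))
              2≤n  = ≤-trans 2≤m (≤-trans (m≤m+n m (k * m)) (≤-reflexive km≡n))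
              sys′ = system {k = 1} {n} {[ c′ ]} refl (len ∷ [])
                       (subst Unique (sym (++-identityʳ c′)) (Unique-resp-↭ (↭-sym c′↭) uniq))
              no   = no-on-k _ (graph-isCycleUnion (c ∷ cs) 2≤m km≡n sys)
              yes  = yes-on-1 _ (graph-isCycleUnion [ c′ ] 2≤n (*-identityˡ n) sys′)
          in case ≡.trans (sym no) (≡.trans (dec _ (graph-consistent 2≤m sys av (λ _ l → l)))
                  (≡.trans (sym (dec _ (graph-consistent 2≤n sys′ av′ keeps′))) yes)) of λ () }

-- A tree that is right on both classes of graphs computes a total extension of the partial
-- function, and conversely, so bounding every such `T` bounds the query complexity. With n = km,
-- the bound for m² is multiplied by k².
theorem4p5 : (n k : ℕ) → 0 < n → 2 ≤ k → k ∣ n → 3 * k ≤ n → .{{_ : NonZero k}} →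
    (T : DTree (Pair n)) →
    (∀ x → IsCycleUnion n 1 n x → eval T x ≡ true) →
    (∀ x → IsCycleUnion n k (n / k) x → eval T x ≡ false) →
    n * n ≤ 128 * (k * k) * depth T
theorem4p5 n k@(suc k-1) _ _ k∣n 3k≤n T yes-on-1 no-on-k = begin
  n * n                   ≡⟨ cong₂ _*_ km≡n km≡n ⟨
  (k * m) * (k * m)       ≡⟨ eq₁ k m ⟩
  (k * k) * (m * m)
    ≤⟨ *-monoʳ-≤ (k * k) (Adversary.depth-bound n m {k-1} 2≤m km≡n T yes-on-1 no-on-k) ⟩
  (k * k) * (128 * depth T) ≡⟨ eq₂ (k * k) (depth T) ⟩
  128 * (k * k) * depth T ∎
  where
  open ≤-Reasoning
  m = n / k
  km≡n : k * m ≡ n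
  km≡n = ≡.trans (*-comm k m) (m/n*n≡m k∣n)
  2≤m : 2 ≤ m
  -- Cancelling `k` in `3 * k ≤ n` gives `3 ≤ m`.
  2≤m = ≤-trans (n≤1+n 2) (*-cancelˡ-≤ k (subst₂ _≤_ (*-comm 3 k) (sym km≡n) 3k≤n))
  eq₁ : ∀ k m → (k * m) * (k * m) ≡ (k * k) * (m * m)
  eq₁ = solve-∀
  eq₂ : ∀ a d → a * (128 * d) ≡ 128 * a * d
  eq₂ = solve-∀
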